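{- The Boltzmann weights (generalised Gamma-Gamma ice) $$a_1(i,j)=t_jz_i+z_j,\quad a_2(i,j)=t_iz_j+z_i,\quad b_1(i,j)=t_iz_j-t_jz_i,\quad b_2(i,j)=z_i-z_j,\quad c_1(i,j)=(t_i+1)z_i,\quad c_2(i,j)=(t_j+1)z_j$$ satisfy the Yang–Baxter equation: for all labels $i,j,k$, all parameters $z_i,z_j,z_k,t_i,t_j,t_k\in\mathbb{C}$ and every orientation $\sigma$ of the six external edges, $Z_A(\sigma)=Z_B(\sigma)$.
   Context: Six-vertex conventions. Lines are drawn in the plane; each line carries a label $\ell$ with a spectral parameter $z_\ell\in\mathbb{C}$ and a deformation parameter $t_\ell\in\mathbb{C}$. Every edge is oriented either "left" or "right". A vertex is a transversal crossing of an ascending line (lower left to upper right) with label $p$ and a descending line (upper left to lower right) with label $q$; its edges are BL, TR on the ascending line and TL, BR on the descending line. Admissible types: $a_1$: all four edges point left; $a_2$: all point right; $b_1$: BL, TR left and TL, BR right; $b_2$: BL, TR right and TL, BR left; $c_1$: TL, TR left and BL, BR right; $c_2$: TL, TR right and BL, BR left. A vertex of type $x$ has weight $x(p,q)$ (the formula with $(i,j)$ replaced by $(p,q)$); other configurations have weight $0$. Networks. For labels $i,j,k$: external edges $L_k,L_j,L_i$ (left ends) and $R_i,R_j,R_k$ (right ends). Network A: internal edges $e_i,e_j,e_k$; vertex $V_1$ with labels $(p,q)=(j,k)$, BL$=L_j$, TL$=L_k$, TR$=e_j$, BR$=e_k$; $V_2$ with $(i,k)$, BL$=L_i$, TL$=e_k$,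 TR$=e_i$, BR$=R_k$; $V_3$ with $(i,j)$, BL$=e_i$, TL$=e_j$, TR$=R_i$, BR$=R_j$. Network B: internal edges $f_i,f_j,f_k$; $W_1$ with $(i,j)$, BL$=L_i$, TL$=L_j$, TR$=f_i$, BR$=f_j$; $W_2$ with $(i,k)$, BL$=f_i$, TL$=L_k$, TR$=R_i$, BR$=f_k$; $W_3$ with $(j,k)$, BL$=f_j$, TL$=f_k$, TR$=R_j$, BR$=R_k$. $Z_A(\sigma)$, $Z_B(\sigma)$ denote the sums over internal edge orientations of the products of the three vertex weights. -}

module Defs where

open import Level using (Level)
open import Algebra.Bundles using (CommutativeRing)

data Dir : Set where
  left right : Dir

-- Generalised Gamma-Gamma ice over an arbitrary commutative ring R
-- (the paper works over ℂ, which is a commutative ring).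
module Ice {c ℓ : Level} (R : CommutativeRing c ℓ) where
  open CommutativeRing R

  -- Weight of a vertex whose ascending line has label p (parameters zp, tp)
  -- and descending line has label q (parameters zq, tq), with edge
  -- orientations BL TL TR BR.
  weight : Carrier → Carrier → Carrier → Carrier → Dir → Dir → Dir → Dir → Carrier
  weight zp tp zq tq left  left  left  left  = tq * zp + zq
  weight zp tp zq tq right right right right = tp * zq + zp
  weight zp tp zq tq left  right left  right = tp * zq - tq * zp
  weight zp tp zq tq right left  right left  = zp - zq
  weight zp tp zq tq right left  left  right = (tp + 1#) * zp
  weight zp tp zq tq left  right right left  = (tq + 1#) * zq
  weight zp tp zq tq _     _     _     _     = 0#

  sumDir : (Dir → Carrier) → Carrier
  sumDir f = f left + f right

  ZA : (zi zj zk ti tj tk : Carrier) (Lk Lj Li Ri Rj Rk : Dir) → Carrier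
  ZA zi zj zk ti tj tk Lk Lj Li Ri Rj Rk =
    sumDir λ ei → sumDir λ ej → sumDir λ ek →
      weight zj tj zk tk Lj Lk ej ek
      * (weight zi ti zk tk Li ek ei Rk
      * weight zi ti zj tj ei ej Ri Rj)

  ZB : (zi zj zk ti tj tk : Carrier) (Lk Lj Li Ri Rj Rk : Dir) → Carrier
  ZB zi zj zk ti tj tk Lk Lj Li Ri Rj Rk =
    sumDir λ fi → sumDir λ fj → sumDir λ fk →
      weight zi ti zj tj Li Lj fi fj
      * (weight zi ti zk tk fi Lk Ri fk
      * weight zj tj zk tk fj fk Rj Rk)

{-# OPTIONS --safe #-}

-- For each of the 64 boundary orientations the equation is an identity of
-- polynomials over ℤ in the six parameters.  Both partition functions are
-- reflected into the syntax of the ring solver, and the comparison of their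
-- normal forms is settled by computation; integer coefficients are needed since
-- equality with 0 in R is not assumed decidable.

module Submission where

open import Defs
open import Level using (Level; 0ℓ)
open import Algebra.Bundles using (CommutativeRing; RawRing)
open import Algebra.Solver.Ring.AlmostCommutativeRing using (_-Raw-AlmostCommutative⟶_; fromCommutativeRing)
open import Data.Fin.Patterns using (0F; 1F; 2F; 3F; 4F; 5F)
open import Data.Maybe as Maybe using (Maybe; Is-just; to-witness)
open import Data.Maybe.Relation.Unary.Any using (dec)
open import Data.Nat.Base as ℕ using (ℕ)
open import Data.Product.Base using (_×_; _,_)
open import Data.Unit.Base using (tt)
open import Data.Vec.Base using ([]; _∷_)
open import Relation.Binary.PropositionalEquality.Core using (_≡_)
open import Relation.Nullary.Decidable using (Dec; yes; map′; _×-dec_; toWitness; dec⇒maybe)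
import Algebra.Properties.CommutativeSemigroup as CommutativeSemigroupProperties
import Algebra.Properties.Ring as RingProperties
import Algebra.Properties.Semiring.Mult as SemiringMult
import Algebra.Solver.Ring as RingSolver
import Data.Nat.Properties as ℕ
import Relation.Binary.Reasoning.Setoid as SetoidReasoning

-- The pair (a , b) stands for the integer a − b.
formalDifferences : RawRing 0ℓ 0ℓ
formalDifferences = record
  { Carrier = ℕ × ℕ
  ; _≈_     = λ (a , b) (c , d) → a ℕ.+ d ≡ c ℕ.+ b
  ; _+_     = λ (a , b) (c , d) → a ℕ.+ c , b ℕ.+ d
  ; _*_     = λ (a , b) (c , d) → a ℕ.* c ℕ.+ b ℕ.* d , a ℕ.* d ℕ.+ b ℕ.* c
  ; -_      = λ (a , b) → b , a
  ; 0#      = 0 , 0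
  ; 1#      = 1 , 0
  }

-- Nested six times, this turns the claim about all boundary orientations into a single decision.
∀-Dir? : ∀ {p} {P : Dir → Set p} → (∀ d → Dec (P d)) → Dec (∀ d → P d)
∀-Dir? P? = map′ (λ { (l , r) left → l ; (l , r) right → r })
                 (λ f → f left , f right)
                 (P? left ×-dec P? right)

module _ {c ℓ : Level} (R : CommutativeRing c ℓ) where
  open CommutativeRing R
  open Ice R
  open RingProperties ring
  open CommutativeSemigroupProperties +-commutativeSemigroup using (interchange)
  open SemiringMult semiring using (×-homo-+; ×1-homo-*; ×-homo-1; ×-congˡ) renaming (_×_ to _·_)
  open SetoidReasoning setoid

  [x-y]+[u-v]≈[x+u]-[y+v] : ∀ x y u v → (x - y) + (u - v) ≈ (x + u) - (y + v)
  [x-y]+[u-v]≈[x+u]-[y+v] x y u v = begin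
    (x - y) + (u - v)      ≈⟨ interchange x (- y) u (- v) ⟩
    (x + u) + (- y - v)    ≈⟨ +-congˡ (-‿+-comm y v) ⟩
    (x + u) - (y + v)      ∎

  [x-y]*[u-v]≈[xu+yv]-[xv+yu] : ∀ x y u v →
    (x - y) * (u - v) ≈ (x * u + y * v) - (x * v + y * u)
  [x-y]*[u-v]≈[xu+yv]-[xv+yu] x y u v = begin
    (x - y) * (u - v)                        ≈⟨ [y-z]x≈yx-zx (u - v) x y ⟩
    x * (u - v) - y * (u - v)                ≈⟨ +-cong (x[y-z]≈xy-xz x u v) (-‿cong (x[y-z]≈xy-xz y u v)) ⟩
    -- Reversing the subtracted difference leaves a sum of two differences, to which the addition
    -- law applies.
    (x * u - x * v) - (y * u - y * v)        ≈⟨ +-congˡ (⁻¹-anti-homo‿- (y * u) (y * v)) ⟩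
    (x * u - x * v) + (y * v - y * u)        ≈⟨ [x-y]+[u-v]≈[x+u]-[y+v] _ _ _ _ ⟩
    (x * u + y * v) - (x * v + y * u)        ∎

  x-y≈[x+v]-[y+v] : ∀ x y v → x - y ≈ (x + v) - (y + v)
  x-y≈[x+v]-[y+v] x y v = begin
    x - y                ≈⟨ +-identityʳ (x - y) ⟨
    (x - y) + 0#         ≈⟨ +-congˡ (-‿inverseʳ v) ⟨
    (x - y) + (v - v)    ≈⟨ [x-y]+[u-v]≈[x+u]-[y+v] x y v v ⟩
    (x + v) - (y + v)    ∎

  -- Both differences are brought to the common subtrahend `y + v`. This transfers equality of
  -- formal differences, which is tested in ℕ, to `R`.
  x+v≈u+y⇒x-y≈u-v : ∀ {x y u v} → x + v ≈ u + y → x - y ≈ u - v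
  x+v≈u+y⇒x-y≈u-v {x} {y} {u} {v} x+v≈u+y = begin
    x - y                ≈⟨ x-y≈[x+v]-[y+v] x y v ⟩
    (x + v) - (y + v)    ≈⟨ +-cong x+v≈u+y (-‿cong (+-comm y v)) ⟩
    (u + y) - (v + y)    ≈⟨ x-y≈[x+v]-[y+v] u v y ⟨
    u - v                ∎

  -- The canonical map from ℤ to `R`, written on representatives.
  ⟦_⟧ᶜ : ℕ × ℕ → Carrier
  ⟦ a , b ⟧ᶜ = a · 1# - b · 1#

  0-homo : ⟦ 0 , 0 ⟧ᶜ ≈ 0#
  0-homo = -‿inverseʳ 0#

  1-homo : ⟦ 1 , 0 ⟧ᶜ ≈ 1#
  1-homo = begin
    1 · 1# - 0#    ≈⟨ +-cong (×-homo-1 1#) -0#≈0# ⟩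
    1# + 0#        ≈⟨ +-identityʳ 1# ⟩
    1#             ∎

  differences⟶R : formalDifferences -Raw-AlmostCommutative⟶ fromCommutativeRing R
  differences⟶R = record
    { ⟦_⟧    = ⟦_⟧ᶜ
    ; +-homo = λ (a , b) (c , d) →
        trans (+-cong (×-homo-+ 1# a c) (-‿cong (×-homo-+ 1# b d)))
              (sym ([x-y]+[u-v]≈[x+u]-[y+v] _ _ _ _))
    ; *-homo = λ (a , b) (c , d) →
        trans (+-cong (sums a c b d) (-‿cong (sums a d b c)))
              (sym ([x-y]*[u-v]≈[xu+yv]-[xv+yu] _ _ _ _))
    ; -‿homo = λ (a , b) → sym (⁻¹-anti-homo‿- _ _)
    ; 0-homo = 0-homo
    ; 1-homo = 1-homo
    }
    where
    sums : ∀ a c b d → (a ℕ.* c ℕ.+ b ℕ.* d) · 1# ≈ (a · 1#) * (c · 1#) + (b · 1#) * (d · 1#)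
    sums a c b d = trans (×-homo-+ 1# (a ℕ.* c) (b ℕ.* d)) (+-cong (×1-homo-* a c) (×1-homo-* b d))

  -- Only natural numbers are compared, so the test computes although `R` is abstract. It also
  -- identifies `(1 , 1)` with `(0 , 0)`, so cancelled coefficients are recognised as zero. The
  -- answer `nothing` does not assert that the images in `R` differ.
  _≟ᶜ_ : ∀ p q → Maybe (⟦ p ⟧ᶜ ≈ ⟦ q ⟧ᶜ)
  (a , b) ≟ᶜ (c , d) = Maybe.map ⟦≡⟧ (dec⇒maybe (a ℕ.+ d ℕ.≟ c ℕ.+ b))
    where
    ⟦≡⟧ : a ℕ.+ d ≡ c ℕ.+ b → ⟦ a , b ⟧ᶜ ≈ ⟦ c , d ⟧ᶜ
    ⟦≡⟧ a+d≡c+b = x+v≈u+y⇒x-y≈u-v (begin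
      a · 1# + d · 1#    ≈⟨ ×-homo-+ 1# a d ⟨
      (a ℕ.+ d) · 1#     ≈⟨ ×-congˡ a+d≡c+b ⟩
      (c ℕ.+ b) · 1#     ≈⟨ ×-homo-+ 1# c b ⟩
      c · 1# + b · 1#    ∎)

  open RingSolver formalDifferences (fromCommutativeRing R) differences⟶R _≟ᶜ_

  0ᴾ 1ᴾ : ∀ {n} → Polynomial n
  0ᴾ = con (0 , 0)
  1ᴾ = con (1 , 0)

  weightᴾ : ∀ {n} (zp tp zq tq : Polynomial n) → Dir → Dir → Dir → Dir → Polynomial n
  weightᴾ zp tp zq tq left  left  left  left  = tq :* zp :+ zq
  weightᴾ zp tp zq tq right right right right = tp :* zq :+ zp
  weightᴾ zp tp zq tq left  right left  right = tp :* zq :- tq :* zp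
  weightᴾ zp tp zq tq right left  right left  = zp :- zq
  weightᴾ zp tp zq tq right left  left  right = (tp :+ 1ᴾ) :* zp
  weightᴾ zp tp zq tq left  right right left  = (tq :+ 1ᴾ) :* zq
  weightᴾ zp tp zq tq _     _     _     _     = 0ᴾ

  -- All sixteen cases are listed because the catch-all clauses reduce only on concrete
  -- orientations. The constants evaluate to `1 · 1# - 0 · 1#` and `0 · 1# - 0 · 1#`, so the cases
  -- containing them are not definitional.
  ⟦weightᴾ⟧ : ∀ {n} (zp tp zq tq : Polynomial n) BL TL TR BR ρ →
    ⟦ weightᴾ zp tp zq tq BL TL TR BR ⟧ ρ ≈
    weight (⟦ zp ⟧ ρ) (⟦ tp ⟧ ρ) (⟦ zq ⟧ ρ) (⟦ tq ⟧ ρ) BL TL TR BR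
  ⟦weightᴾ⟧ zp tp zq tq left  left  left  left  ρ = refl
  ⟦weightᴾ⟧ zp tp zq tq right right right right ρ = refl
  ⟦weightᴾ⟧ zp tp zq tq left  right left  right ρ = refl
  ⟦weightᴾ⟧ zp tp zq tq right left  right left  ρ = refl
  ⟦weightᴾ⟧ zp tp zq tq right left  left  right ρ = *-congʳ (+-congˡ 1-homo)
  ⟦weightᴾ⟧ zp tp zq tq left  right right left  ρ = *-congʳ (+-congˡ 1-homo)
  ⟦weightᴾ⟧ zp tp zq tq left  left  left  right ρ = 0-homo
  ⟦weightᴾ⟧ zp tp zq tq left  left  right left  ρ = 0-homo
  ⟦weightᴾ⟧ zp tp zq tq left  left  right right ρ = 0-homo
  ⟦weightᴾ⟧ zp tp zq tq left  right left  left  ρ = 0-homo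
  ⟦weightᴾ⟧ zp tp zq tq left  right right right ρ = 0-homo
  ⟦weightᴾ⟧ zp tp zq tq right left  left  left  ρ = 0-homo
  ⟦weightᴾ⟧ zp tp zq tq right left  right right ρ = 0-homo
  ⟦weightᴾ⟧ zp tp zq tq right right left  left  ρ = 0-homo
  ⟦weightᴾ⟧ zp tp zq tq right right left  right ρ = 0-homo
  ⟦weightᴾ⟧ zp tp zq tq right right right left  ρ = 0-homo

  sumDirᴾ : ∀ {n} → (Dir → Polynomial n) → Polynomial n
  sumDirᴾ f = f left :+ f right

  sumDir-cong : ∀ {f g} → (∀ d → f d ≈ g d) → sumDir f ≈ sumDir g
  sumDir-cong f≈g = +-cong (f≈g left) (f≈g right)

  module _ (Lk Lj Li Ri Rj Rk : Dir) where
    zi zj zk ti tj tk : Polynomial 6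
    -- The indices follow the order of the parameters in the environment `ρ`.
    zi = var 0F
    zj = var 1F
    zk = var 2F
    ti = var 3F
    tj = var 4F
    tk = var 5F

    ZAᴾ ZBᴾ : Polynomial 6
    ZAᴾ = sumDirᴾ λ ei → sumDirᴾ λ ej → sumDirᴾ λ ek →
      weightᴾ zj tj zk tk Lj Lk ej ek
      :* (weightᴾ zi ti zk tk Li ek ei Rk
      :* weightᴾ zi ti zj tj ei ej Ri Rj)
    ZBᴾ = sumDirᴾ λ fi → sumDirᴾ λ fj → sumDirᴾ λ fk →
      weightᴾ zi ti zj tj Li Lj fi fj
      :* (weightᴾ zi ti zk tk fi Lk Ri fk
      :* weightᴾ zj tj zk tk fj fk Rj Rk)

    -- Evaluation passes through sums and products by computation, so only the vertex weights need
    -- an argument.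
    ⟦ZAᴾ⟧ : ∀ a b c d e f → ⟦ ZAᴾ ⟧ (a ∷ b ∷ c ∷ d ∷ e ∷ f ∷ []) ≈ ZA a b c d e f Lk Lj Li Ri Rj Rk
    ⟦ZAᴾ⟧ a b c d e f = sumDir-cong λ ei → sumDir-cong λ ej → sumDir-cong λ ek →
      *-cong (⟦weightᴾ⟧ zj tj zk tk Lj Lk ej ek ρ)
      (*-cong (⟦weightᴾ⟧ zi ti zk tk Li ek ei Rk ρ)
      (⟦weightᴾ⟧ zi ti zj tj ei ej Ri Rj ρ))
      where ρ = a ∷ b ∷ c ∷ d ∷ e ∷ f ∷ []

    ⟦ZBᴾ⟧ : ∀ a b c d e f → ⟦ ZBᴾ ⟧ (a ∷ b ∷ c ∷ d ∷ e ∷ f ∷ []) ≈ ZB a b c d e f Lk Lj Li Ri Rj Rk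
    ⟦ZBᴾ⟧ a b c d e f = sumDir-cong λ fi → sumDir-cong λ fj → sumDir-cong λ fk →
      *-cong (⟦weightᴾ⟧ zi ti zj tj Li Lj fi fj ρ)
      (*-cong (⟦weightᴾ⟧ zi ti zk tk fi Lk Ri fk ρ)
      (⟦weightᴾ⟧ zj tj zk tk fj fk Rj Rk ρ))
      where ρ = a ∷ b ∷ c ∷ d ∷ e ∷ f ∷ []

  normalise-ZAᴾ≟ZBᴾ : ∀ Lk Lj Li Ri Rj Rk →
    Is-just (normalise (ZAᴾ Lk Lj Li Ri Rj Rk) ≟N normalise (ZBᴾ Lk Lj Li Ri Rj Rk))
  normalise-ZAᴾ≟ZBᴾ = toWitness {a? =
    ∀-Dir? λ Lk → ∀-Dir? λ Lj → ∀-Dir? λ Li → ∀-Dir? λ Ri → ∀-Dir? λ Rj → ∀-Dir? λ Rk →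
    -- `Is-just` is `Any` of a trivial predicate, so deciding it merely inspects the constructor.
    -- The `_` is the comparison of normal forms, inferred from the goal; the final `tt` type-checks
    -- because all 64 comparisons compute to `just`.
    dec (λ _ → yes tt) _} tt

  ZA≈ZB : ∀ zi zj zk ti tj tk Lk Lj Li Ri Rj Rk →
    ZA zi zj zk ti tj tk Lk Lj Li Ri Rj Rk ≈ ZB zi zj zk ti tj tk Lk Lj Li Ri Rj Rk
  ZA≈ZB zi zj zk ti tj tk Lk Lj Li Ri Rj Rk = begin
    ZA zi zj zk ti tj tk Lk Lj Li Ri Rj Rk    ≈⟨ ⟦ZAᴾ⟧ Lk Lj Li Ri Rj Rk zi zj zk ti tj tk ⟨
    ⟦ A ⟧ ρ                                   ≈⟨ correct A ρ ⟨
    -- The equality of normal forms does not depend on the parameters; they enter only through its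
    -- evaluation at `ρ`.
    ⟦ A ⟧↓ ρ                                  ≈⟨ ⟦ to-witness (normalise-ZAᴾ≟ZBᴾ Lk Lj Li Ri Rj Rk) ⟧N-cong ρ ⟩
    ⟦ B ⟧↓ ρ                                  ≈⟨ correct B ρ ⟩
    ⟦ B ⟧ ρ                                   ≈⟨ ⟦ZBᴾ⟧ Lk Lj Li Ri Rj Rk zi zj zk ti tj tk ⟩
    ZB zi zj zk ti tj tk Lk Lj Li Ri Rj Rk    ∎
    where
    A = ZAᴾ Lk Lj Li Ri Rj Rk
    B = ZBᴾ Lk Lj Li Ri Rj Rk
    ρ = zi ∷ zj ∷ zk ∷ ti ∷ tj ∷ tk ∷ []

theorem5p1 : {c ℓ : Level} (R : CommutativeRing c ℓ) →
    (zi zj zk ti tj tk : CommutativeRing.Carrier R) →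
    (Lk Lj Li Ri Rj Rk : Dir) →
    CommutativeRing._≈_ R
    (Ice.ZA R zi zj zk ti tj tk Lk Lj Li Ri Rj Rk)
    (Ice.ZB R zi zj zk ti tj tk Lk Lj Li Ri Rj Rk)
theorem5p1 = ZA≈ZB
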